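{- Let $\sigma=\sigma(1)\sigma(2)\cdots\sigma(n)$ be a permutation of $\{1,2,\ldots,n\}$. Then $\sigma$ is a short Catalan--Spitzer permutation (i.e., a short $2$-Catalan--Spitzer permutation of order $n$) if and only if its Foata--Strehl tree $\mathcal{FS}(\sigma)$ is levelwise numbered. Moreover, for an integer $k\geq 2$, $\sigma$ is a short $k$-Catalan--Spitzer permutation (of some order) if and only if $\mathcal{FS}(\sigma)$ is levelwise numbered and, in addition, every maximal path in $\mathcal{FS}(\sigma)$ all of whose edges join a vertex to its right child (a single vertex counting as such a path when it has no right child and is not the right child of its parent) has a number of vertices that is a multiple of $k-1$.
   Context: Let $k\geq 2$, $n\geq 0$. A $k$-Catalan--Spitzer path of order $n$ is a lattice path $(0,z'_0),(1,z'_1),\ldots,(kn+1,z'_{kn+1})$ with $z'_0=z'_{kn+1}=0$, consisting of $(k-1)n+1$ up steps $(1,n)$ and $n$ down steps $(1,-((k-1)n+1))$, such that $z'_i>0$ for $1\leq i\leq kn$. Given such a path, let $i_1<i_2<\cdots<i_{(k-1)n}$ be the indices $i\in\{1,\ldots,kn\}$ with $z'_i<z'_{i+1}$ (there are exactly $(k-1)n$ of them). The short $k$-Catalan--Spitzer permutation of the path is the permutation $\sigma$ of $\{1,\ldots,(k-1)n\}$ with $\sigma(a)<\sigma(b)$ iff $z'_{i_a}<z'_{i_b}$. For $k=2$ these are called short Catalan--Spitzer permutations (of order $n$, permutations of $\{1,\ldots,n\}$). A plane $0$-$1$-$2$ tree is a rooted tree in which each vertex has at most one left child and at most one right child. The Foata--Strehl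 tree $\mathcal{FS}(w_1\cdots w_m)$ of a word with distinct letters from an ordered alphabet is defined recursively: its root is labeled $w_i=\min(w_1,\ldots,w_m)$, the left subtree of the root is $\mathcal{FS}(w_1\cdots w_{i-1})$ (absent if $i=1$), and the right subtree is $\mathcal{FS}(w_{i+1}\cdots w_m)$ (absent if $i=m$); vertices are labeled by the letters. The level of a vertex of a plane $0$-$1$-$2$ tree is the number of steps from a parent to its right child on the unique path from the root to the vertex. A plane $0$-$1$-$2$ tree with vertices labeled bijectively by $1,\ldots,m$ is levelwise numbered if: (1) whenever the level of the vertex labeled $i$ is less than the level of the vertex labeled $j$, then $i<j$; (2) whenever the vertex labeled $j$ is in the left subtree of the vertex labeled $i$, then $i<j$; (3) whenever the vertices labeled $i$ and $j$ have the same level and there is a label $l<i,j$ such that the vertex labeled $i$ is in the right subtree and the vertex labeled $j$ is in the left subtree of the vertex labeled $l$, then $i<j$. -}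

module Defs where

open import Data.Nat using (ℕ; zero; suc; _+_; _*_; _∸_; _⊓_; _<_; _≤_; _≟_; _<?_)
open import Data.Nat.Divisibility using (_∣_)
open import Data.Integer as ℤ using (ℤ; +_; -_)
open import Data.Fin using (Fin; toℕ)
open import Data.Fin.Permutation using (Permutation′; _⟨$⟩ʳ_)
open import Data.List using (List; []; _∷_; _++_; length; map; foldr; filter; takeWhile; dropWhile; drop; upTo; allFin; take; sum)
open import Data.Maybe using (Maybe; just; nothing)
open import Data.Product using (Σ; ∃; ∃-syntax; _×_; _,_)
open import Data.Sum using (_⊎_)
open import Relation.Binary.PropositionalEquality using (_≡_)
open import Relation.Nullary using (¬_)
open import Relation.Nullary.Decidable using (does)
open import Function.Bundles using (_⇔_)

data Step : Set where
  up down : Step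

-- increment in the y-coordinate of a step, for parameters k, n:
-- up = (1, n), down = (1, -((k-1)n+1))
stepVal : ℕ → ℕ → Step → ℤ
stepVal k n up   = + n
stepVal k n down = - (+ ((k ∸ 1) * n + 1))

countUp : List Step → ℕ
countUp [] = 0
countUp (up ∷ s) = suc (countUp s)
countUp (down ∷ s) = countUp s

countDown : List Step → ℕ
countDown [] = 0
countDown (up ∷ s) = countDown s
countDown (down ∷ s) = suc (countDown s)

height : ℕ → ℕ → List Step → ℕ → ℤ
height k n s i = sum' (map (stepVal k n) (take i s))
  where
  sum' : List ℤ → ℤ
  sum' = foldr ℤ._+_ (+ 0)

record IsCSPath (k n : ℕ) (s : List Step) : Set where
  field
    ups      : countUp s ≡ (k ∸ 1) * n + 1
    downs    : countDown s ≡ n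
    len      : length s ≡ k * n + 1
    ends     : height k n s (k * n + 1) ≡ + 0
    positive : ∀ i → 1 ≤ i → i ≤ k * n → + 0 ℤ.< height k n s i

ascentIndices : ℕ → ℕ → List Step → List ℕ
ascentIndices k n s =
  filter (λ i → height k n s i ℤ.<? height k n s (suc i)) (map suc (upTo (k * n)))

-- list lookup with default 0 (only used within range)
nth : List ℕ → ℕ → ℕ
nth [] _ = 0
nth (x ∷ xs) zero = x
nth (x ∷ xs) (suc j) = nth xs j

IsShortKCS : (k n : ℕ) {m : ℕ} → Permutation′ m → Set
IsShortKCS k n {m} σ =
  (m ≡ (k ∸ 1) * n) ×
  ∃[ s ] (IsCSPath k n s ×
    (∀ (a b : Fin m) →
      (toℕ (σ ⟨$⟩ʳ a) < toℕ (σ ⟨$⟩ʳ b)) ⇔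
      (height k n s (nth (ascentIndices k n s) (toℕ a))
        ℤ.< height k n s (nth (ascentIndices k n s) (toℕ b)))))

-- Plane 0-1-2 trees with ℕ labels (leaf = absent subtree)

data Tree : Set where
  leaf : Tree
  node : Tree → ℕ → Tree → Tree

word : {m : ℕ} → Permutation′ m → List ℕ
word {m} σ = map (λ a → suc (toℕ (σ ⟨$⟩ʳ a))) (allFin m)

-- Foata--Strehl tree (with fuel = length of the word, which suffices)
FS′ : ℕ → List ℕ → Tree
FS′ zero _ = leaf
FS′ (suc f) [] = leaf
FS′ (suc f) (x ∷ xs) =
  node (FS′ f (takeWhile notEq (x ∷ xs)))
       μ
       (FS′ f (drop 1 (dropWhile notEq (x ∷ xs))))
  where
  μ : ℕ
  μ = foldr _⊓_ x xs
  open import Relation.Nullary.Decidable using (¬?)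
  notEq = λ (y : ℕ) → ¬? (y ≟ μ)

FS : List ℕ → Tree
FS w = FS′ (length w) w

data Dir : Set where
  L R : Dir

labelAt : Tree → List Dir → Maybe ℕ
labelAt leaf _ = nothing
labelAt (node l x r) [] = just x
labelAt (node l x r) (L ∷ p) = labelAt l p
labelAt (node l x r) (R ∷ p) = labelAt r p

subtreeAt : Tree → List Dir → Tree
subtreeAt t [] = t
subtreeAt leaf (_ ∷ _) = leaf
subtreeAt (node l x r) (L ∷ p) = subtreeAt l p
subtreeAt (node l x r) (R ∷ p) = subtreeAt r p

level : List Dir → ℕ
level [] = 0
level (L ∷ p) = level p
level (R ∷ p) = suc (level p)

-- levelwise numbered (conditions (1)–(3)); vertices are identified with
-- their addresses, labels are read off with labelAt
record LevelwiseNumbered (T : Tree) : Set where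
  field
    cond1 : ∀ p q i j → labelAt T p ≡ just i → labelAt T q ≡ just j →
            level p < level q → i < j
    cond2 : ∀ p q i j → labelAt T p ≡ just i → labelAt T q ≡ just j →
            (∃[ r ] q ≡ p ++ (L ∷ r)) → i < j
    cond3 : ∀ p q s i j l → labelAt T p ≡ just i → labelAt T q ≡ just j →
            labelAt T s ≡ just l → level p ≡ level q → l < i → l < j →
            (∃[ r ] p ≡ s ++ (R ∷ r)) → (∃[ r ] q ≡ s ++ (L ∷ r)) → i < j

rightSpine : Tree → ℕ
rightSpine leaf = 0
rightSpine (node l x r) = suc (rightSpine r)

-- every maximal right path (starting at a vertex which is the root or a
-- left child, following right children as far as possible) has a number
-- of vertices divisible by d
RightPathsDivisible : ℕ → Tree → Set
RightPathsDivisible d T =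
  ∀ p → (p ≡ [] ⊎ ∃[ q ] p ≡ q ++ (L ∷ [])) →
  (∃[ x ] labelAt T p ≡ just x) → d ∣ rightSpine (subtreeAt T p)

{-# OPTIONS --safe #-}

-- Put d = k − 1 and measure a path after its initial up step by its level, where
-- an up step counts +1 and a down step −d.  A vertex at level h preceded by v down
-- steps has y-coordinate (h + 1) n − v with v < n, so heights are compared by level
-- first and, within a level, the later vertex is the lower one.  Hence σ is short
-- k-Catalan–Spitzer iff its order is the one given by the starting levels of the up
-- steps of some walk from 0 to 0.  On the other side, levelwise numbering says that
-- σ is ordered in the same way by the tree levels of FS(σ) read in inorder.  The
-- minimum of σ is the last up step from level 0, so by induction the two level
-- sequences agree.  A right path of the tree is a run of up steps whose total
-- rise must be undone by down steps of size d, which is the divisibility condition.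
module Submission where

open import Defs
open import Data.Nat using (ℕ; zero; suc; _+_; _*_; _∸_; _⊓_; _≤_; _<_; _≟_; _<?_; _≤?_; z≤n; s≤s; s≤s⁻¹; z<s)
open import Data.Nat.Properties
open import Data.Nat.Divisibility using (_∣_; divides; _∣0; 1∣_)
open import Data.Nat.Tactic.RingSolver using (solve-∀)
open import Data.Integer as ℤ using (ℤ; +_; -_; _⊖_)
import Data.Integer.Properties as ℤₚ
open import Data.Fin as Fin using (Fin; toℕ)
import Data.Fin.Properties as Finₚ
open import Data.Fin.Permutation using (Permutation′; _⟨$⟩ʳ_)
open import Data.List using (List; []; _∷_; _++_; length; map; foldr; filter; applyUpTo; tabulate; lookup; replicate; takeWhile; dropWhile; drop)
open import Data.List.Properties
open import Data.List.Membership.Propositional using (_∈_)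
open import Data.List.Membership.Propositional.Properties using (∈-∃++; foldr-selective; ∈-++⁺ˡ; ∈-++⁺ʳ)
open import Data.List.Relation.Unary.All as All using (All; []; _∷_)
import Data.List.Relation.Unary.All.Properties as Allₚ
open import Data.List.Relation.Unary.AllPairs using (AllPairs; []; _∷_)
import Data.List.Relation.Unary.AllPairs.Properties as AllPairsₚ
open import Data.List.Relation.Unary.Any as Any using ()
open import Data.List.Relation.Unary.Unique.Propositional using (Unique)
import Data.List.Relation.Unary.Unique.Propositional.Properties as Uniqueₚ
open import Data.Maybe using (just)
open import Data.Product using (∃₂; ∃-syntax; _×_; _,_; proj₁; proj₂)
open import Data.Sum as Sum using (_⊎_; inj₁; inj₂)
open import Data.Unit using (⊤; tt)
open import Function using (_∘_)
open import Function.Bundles using (_⇔_; mk⇔; Equivalence; Injection)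
open import Function.Properties.Inverse using (↔⇒↣)
open import Relation.Binary.Definitions using (tri<; tri≈; tri>; Asymmetric)
open import Relation.Binary.PropositionalEquality
open import Relation.Nullary using (¬_; yes; no; contradiction)
open import Relation.Nullary.Decidable using (¬?; dec-true; dec-false)

private variable
  X Y : Set
  d h c v n m : ℕ
  s s′ : List Step
  A B : List ℕ
  T : Tree

-- Orders governed by a level sequence

-- The first pair precedes the second in a sequence of (level, value) pairs whose
-- values are ordered by level and, within a level, decrease along the sequence.
Agree : (X → X → Set) → ℕ × X → ℕ × X → Set
Agree _≺_ (h , x) (h′ , x′) = (h < h′ × x ≺ x′) ⊎ (h′ ≤ h × x′ ≺ x)

module _ (_≺_ : X → X → Set) (_⊏_ : Y → Y → Set) (asym : Asymmetric _≺_)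
         {a b : ℕ} {x x′ : X} {y y′ : Y} where

  Agree-transfer< : Agree _≺_ (a , x) (b , x′) → Agree _⊏_ (a , y) (b , y′) → x ≺ x′ → y ⊏ y′
  Agree-transfer< (inj₂ (_ , x′≺x)) _                x≺x′ = contradiction x′≺x (asym x≺x′)
  Agree-transfer< (inj₁ _)          (inj₁ (_ , r))   _    = r
  Agree-transfer< (inj₁ (a<b , _))  (inj₂ (b≤a , _)) _    = contradiction b≤a (<⇒≱ a<b)

  Agree-transfer> : Agree _≺_ (a , x) (b , x′) → Agree _⊏_ (a , y) (b , y′) → x′ ≺ x → y′ ⊏ y
  Agree-transfer> (inj₁ (_ , x≺x′)) _                x′≺x = contradiction x′≺x (asym x≺x′)
  Agree-transfer> (inj₂ _)          (inj₂ (_ , r))   _    = r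
  Agree-transfer> (inj₂ (b≤a , _))  (inj₁ (a<b , _)) _    = contradiction b≤a (<⇒≱ a<b)

-- For `a` before `b`, the branch of `Agree` is settled by comparing `f a` with `f b`, so two
-- families of values over the same levels fall into the same branch. Pairs in reverse order are
-- swapped first.
Agree-tabulate-⇔ : (_≺_ : X → X → Set) (_⊏_ : Y → Y → Set) →
  {f : Fin m → ℕ} {x : Fin m → X} {y : Fin m → Y} →
  Asymmetric _≺_ → Asymmetric _⊏_ →
  (∀ {a b} → a Fin.< b → Agree _≺_ (f a , x a) (f b , x b)) →
  (∀ {a b} → a Fin.< b → Agree _⊏_ (f a , y a) (f b , y b)) →
  ∀ a b → x a ≺ x b ⇔ y a ⊏ y b
Agree-tabulate-⇔ _≺_ _⊏_ asym≺ asym⊏ px py a b with Finₚ.<-cmp a b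
... | tri< a<b _ _ = mk⇔ (Agree-transfer< _≺_ _⊏_ asym≺ (px a<b) (py a<b))
                         (Agree-transfer< _⊏_ _≺_ asym⊏ (py a<b) (px a<b))
... | tri> _ _ b<a = mk⇔ (Agree-transfer> _≺_ _⊏_ asym≺ (px b<a) (py b<a))
                         (Agree-transfer> _⊏_ _≺_ asym⊏ (py b<a) (px b<a))
... | tri≈ _ refl _ = mk⇔ (λ r → contradiction r (asym≺ r)) (λ r → contradiction r (asym⊏ r))

-- Walks between levels

-- The levels count up steps as +1 and down steps as −d; A lists the
-- starting levels of the up steps.
data Walk (d : ℕ) : ℕ → List Step → List ℕ → ℕ → Set where
  done : Walk d h [] [] h
  rise : Walk d (suc h) s A c → Walk d h (up ∷ s) (h ∷ A) c
  fall : Walk d h s A c → Walk d (d + h) (down ∷ s) A c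

Walk-count : Walk d h s A c → h + countUp s ≡ d * countDown s + c
Walk-count {d} {h} done rewrite *-zeroʳ d = +-identityʳ h
Walk-count {h = h} (rise {s = s} w) = trans (+-suc h (countUp s)) (Walk-count w)
Walk-count {d} {c = c} (fall {h = h} {s = s} w) = begin
  d + h + countUp s              ≡⟨ +-assoc d h _ ⟩
  d + (h + countUp s)            ≡⟨ cong (λ x → d + x) (Walk-count w) ⟩
  d + (d * countDown s + c)      ≡⟨ +-assoc d _ c ⟨
  d + d * countDown s + c        ≡⟨ cong (_+ c) (*-suc d (countDown s)) ⟨
  d * suc (countDown s) + c      ∎
  where open ≡-Reasoning

Walk-length : Walk d h s A c → length A ≡ countUp s
Walk-length done     = refl
Walk-length (rise w) = cong suc (Walk-length w)
Walk-length (fall w) = Walk-length w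

length-steps : ∀ s → length s ≡ countUp s + countDown s
length-steps []         = refl
length-steps (up ∷ s)   = cong suc (length-steps s)
length-steps (down ∷ s) = trans (cong suc (length-steps s)) (sym (+-suc (countUp s) _))

-- A walk to level 0 that still rises must later descend, by `Walk-count`. Hence at every vertex but
-- the last, the number of down steps passed is below the total.
countDown>0 : ∀ {x} → Walk d h (x ∷ s) A 0 → 0 < countDown (x ∷ s)
countDown>0 (fall w) = z<s
countDown>0 {d} {h} (rise {s = s} w) with countDown s | Walk-count w
... | suc _ | _ = z<s
... | zero  | e rewrite *-zeroʳ d = contradiction e λ ()

Walk-++ : Walk d h s A m → Walk d m s′ B c → Walk d h (s ++ s′) (A ++ B) c
Walk-++ done     u = u
Walk-++ (rise w) u = rise (Walk-++ w u)
Walk-++ (fall w) u = fall (Walk-++ w u)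

-- Down steps preceding the up step recorded as `a` stay in the first piece, which therefore ends
-- exactly at level `a`. The up step itself belongs to neither piece.
Walk-split : ∀ A {a} → Walk d h s (A ++ a ∷ B) c →
  (∃[ s₁ ] Walk d h s₁ A a) × (∃[ s₂ ] Walk d (suc a) s₂ B c)
Walk-split []      (rise w) = (_ , done) , (_ , w)
Walk-split (_ ∷ A) (rise w) with Walk-split A w
... | (_ , w₁) , w₂ = (_ , rise w₁) , w₂
Walk-split []      (fall w) with Walk-split [] w
... | (_ , w₁) , w₂ = (_ , fall w₁) , w₂
Walk-split (x ∷ A) (fall w) with Walk-split (x ∷ A) w
... | (_ , w₁) , w₂ = (_ , fall w₁) , w₂

-- Only down steps can precede the first up step.
Walk-head≤ : ∀ {a} → Walk d h s (a ∷ A) c → a ≤ h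
Walk-head≤ (rise w) = ≤-refl
Walk-head≤ {d} (fall w) = ≤-trans (Walk-head≤ w) (m≤n+m _ d)

Walk-descend : ∀ d t c → Walk d (t * d + c) (replicate t down) [] c
Walk-descend d zero    c = done
Walk-descend d (suc t) c rewrite +-assoc d (t * d) c = fall (Walk-descend d t c)

Walk-[] : Walk d h s [] c → ∃[ t ] h ≡ t * d + c
Walk-[] done = 0 , refl
Walk-[] {d} (fall w) with Walk-[] w
... | t , refl = suc t , sym (+-assoc d (t * d) _)

-- Heights at the up steps

-- An up step is recorded by its starting level and the number of down steps passed, with `v` as the
-- count so far; `ht` turns such a pair into a y-coordinate.
points : Walk d h s A c → ℕ → List (ℕ × ℕ)
points done             v = []
points (rise {h = h} w) v = (h , v) ∷ points w v
points (fall w)         v = points w (suc v)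

points-levels : (w : Walk d h s A c) (v : ℕ) → map proj₁ (points w v) ≡ A
points-levels done     v = refl
points-levels (rise w) v = cong (_ ∷_) (points-levels w v)
points-levels (fall w) v = points-levels w (suc v)

-- Only a down step can lead below the current level. Applied right after an up step from `h`, that
-- is at `suc h`, the disjunction says that a later up step starts above `h` or has a further down
-- step before it, as `ht-Agree` requires.
points-later : (w : Walk d h s A c) (v : ℕ) →
  All (λ (h′ , v′) → v ≤ v′ × (h ≤ h′ ⊎ v < v′)) (points w v)
points-later done     v = []
points-later (rise w) v =
  (≤-refl , inj₁ ≤-refl) ∷ All.map (λ (v≤v′ , later) → v≤v′ , Sum.map₁ <⇒≤ later) (points-later w v)
points-later (fall w) v = All.map (λ (v<v′ , _) → <⇒≤ v<v′ , inj₂ v<v′) (points-later w (suc v))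

countDown-pos⇒< : ∀ {k} → v + k ≡ n → 0 < k → v < n
countDown-pos⇒< {v} {n} refl 0<k = m<m+n v 0<k

points-below : (w : Walk d h s A 0) → v + countDown s ≡ n →
  All (λ (_ , v′) → v′ < n) (points w v)
points-below done       e = []
points-below w@(rise u) e = countDown-pos⇒< e (countDown>0 w) ∷ points-below u e
points-below {v = v} (fall w) e = points-below w (trans (sym (+-suc v _)) e)

-- The y-coordinate of the path after its initial up step: h + 1 more up steps
-- than d times the number v of down steps gives (h + 1) n − v.
ht : ℕ → ℕ × ℕ → ℤ
ht n (h , v) = suc h * n ⊖ v

⊖-< : ∀ a b c d → a + d < c + b → a ⊖ b ℤ.< c ⊖ d
⊖-< a b c d lt = subst₂ ℤ._<_ (ℤₚ.+-cancelˡ-⊖ d a b) (trans (cong ((b + c) ⊖_) (+-comm d b)) (ℤₚ.+-cancelˡ-⊖ b c d))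
  (ℤₚ.⊖-monoˡ-< (d + b) (subst₂ _<_ (+-comm a d) (+-comm c b) lt))

⊖-≥0⇒≤ : ∀ a b → + 0 ℤ.≤ a ⊖ b → b ≤ a
⊖-≥0⇒≤ a b p with b ≤? a
... | yes q = q
... | no q  = contradiction (⊖-< a b 0 0 (subst (_< b) (sym (+-identityʳ a)) (≰⇒> q))) (ℤₚ.≤⇒≯ p)

-- One level is worth `n`, and because `v′ < n` the down-step counts cannot outweigh it. If the
-- level does not increase, `later` leaves only `v < v′`, which makes the later vertex the lower
-- one.
ht-Agree : ∀ {h v h′ v′} → v ≤ v′ → suc h ≤ h′ ⊎ v < v′ → v′ < n →
  Agree ℤ._<_ (h , ht n (h , v)) (h′ , ht n (h′ , v′))
ht-Agree {n} {h} {v} {h′} {v′} v≤v′ later v′<n with h <? h′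
... | yes h<h′ = inj₁ (h<h′ , ⊖-< _ v _ v′ (begin-strict
        suc h * n + v′       <⟨ +-monoʳ-< (suc h * n) v′<n ⟩
        suc h * n + n        ≡⟨ +-comm (suc h * n) n ⟩
        suc (suc h) * n      ≤⟨ *-monoˡ-≤ n (s≤s h<h′) ⟩
        suc h′ * n           ≤⟨ m≤m+n _ v ⟩
        suc h′ * n + v       ∎))
  where open ≤-Reasoning
... | no h≮h′ with later
...   | inj₁ h<h′ = contradiction h<h′ h≮h′
...   | inj₂ v<v′ = inj₂ (≮⇒≥ h≮h′ , ⊖-< _ v′ _ v (+-mono-≤-< (*-monoˡ-≤ n (s≤s (≮⇒≥ h≮h′))) v<v′))

points-Agree : (w : Walk d h s A 0) → v + countDown s ≡ n →
  AllPairs (λ p q → Agree ℤ._<_ (proj₁ p , ht n p) (proj₁ q , ht n q)) (points w v)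
points-Agree done e = []
points-Agree {v = v} (rise w) e =
  All.zipWith (λ ((v≤v′ , later) , v′<n) → ht-Agree v≤v′ later v′<n) (points-later w v , points-below w e)
  ∷ points-Agree w e
points-Agree {v = v} (fall w) e = points-Agree w (trans (sym (+-suc v _)) e)

-- Correspondence of paths and walks

ht-up : ∀ d n h v → ht n (h , v) ℤ.+ stepVal (suc d) n up ≡ ht n (suc h , v)
ht-up d n h v = trans (ℤₚ.distribˡ-⊖-+-pos n (suc h * n) v) (cong (_⊖ v) (+-comm (suc h * n) n))

ht-down : ∀ d n h v → ht n (d + h , v) ℤ.+ stepVal (suc d) n down ≡ ht n (h , suc v)
ht-down d n h v = begin
  ht n (d + h , v) ℤ.+ - (+ (d * n + 1))     ≡⟨ cong (λ x → ht n (d + h , v) ℤ.+ - (+ x)) (+-comm (d * n) 1) ⟩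
  ht n (d + h , v) ℤ.+ ℤ.-[1+ d * n ]        ≡⟨ ℤₚ.distribˡ-⊖-+-neg (d * n) (suc (d + h) * n) v ⟩
  suc (d + h) * n ⊖ (suc v + d * n)          ≡⟨ cong₂ _⊖_ (factor n d h) (+-comm (suc v) (d * n)) ⟩
  (d * n + suc h * n) ⊖ (d * n + suc v)      ≡⟨ ℤₚ.+-cancelˡ-⊖ (d * n) _ _ ⟩
  ht n (h , suc v)                           ∎
  where
  open ≡-Reasoning
  factor : ∀ n d h → suc (d + h) * n ≡ d * n + suc h * n
  factor = solve-∀

height-∷ : ∀ k n x s i z → z ℤ.+ height k n (x ∷ s) (suc i) ≡ (z ℤ.+ stepVal k n x) ℤ.+ height k n s i
height-∷ k n x s i z = sym (ℤₚ.+-assoc z _ _)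

height-up : ∀ d n h v s i →
  ht n (h , v) ℤ.+ height (suc d) n (up ∷ s) (suc i) ≡ ht n (suc h , v) ℤ.+ height (suc d) n s i
height-up d n h v s i = trans (height-∷ (suc d) n up s i (ht n (h , v))) (cong (ℤ._+ height (suc d) n s i) (ht-up d n h v))

height-down : ∀ d n h v s i →
  ht n (d + h , v) ℤ.+ height (suc d) n (down ∷ s) (suc i) ≡ ht n (h , suc v) ℤ.+ height (suc d) n s i
height-down d n h v s i = trans (height-∷ (suc d) n down s i (ht n (d + h , v))) (cong (ℤ._+ height (suc d) n s i) (ht-down d n h v))

height-end : Walk d h s A c → ∀ v →
  ht n (h , v) ℤ.+ height (suc d) n s (length s) ≡ ht n (c , v + countDown s)
height-end {n = n} (done {h = h}) v = trans (ℤₚ.+-identityʳ _) (cong (λ x → ht n (h , x)) (sym (+-identityʳ v)))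
height-end {d} {n = n} (rise {h = h} {s} w) v = trans (height-up d n h v s (length s)) (height-end w v)
height-end {d} {c = c} {n} (fall {h = h} {s} w) v = trans (height-down d n h v s (length s))
  (trans (height-end {n = n} w (suc v)) (cong (λ x → ht n (c , x)) (sym (+-suc v _))))

-- Before the end a down step is still to come, so `v < n`, while the level contributes at least
-- `n`.
height-positive : Walk d h s A 0 → v + countDown s ≡ n → ∀ j → j < length s →
  + 0 ℤ.< ht n (h , v) ℤ.+ height (suc d) n s j
height-positive {h = h} {s = _ ∷ _} {v = v} {n} w e zero _ =
  subst (+ 0 ℤ.<_) (sym (ℤₚ.+-identityʳ (ht n (h , v))))
    (⊖-< 0 0 (suc h * n) v (<-≤-trans (countDown-pos⇒< e (countDown>0 w)) (≤-trans (m≤m+n n (h * n)) (m≤m+n _ 0))))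
height-positive {d} {v = v} {n} (rise {h = h} {s} w) e (suc j) (s≤s j<) =
  subst (+ 0 ℤ.<_) (sym (height-up d n h v s j)) (height-positive w e j j<)
height-positive {d} {v = v} {n} (fall {h = h} {s} w) e (suc j) (s≤s j<) =
  subst (+ 0 ℤ.<_) (sym (height-down d n h v s j)) (height-positive w (trans (sym (+-suc v _)) e) j j<)

-- The point is that a down step needs `d ≤ h`. A nonnegative y-coordinate after it gives
-- `v + 1 + d * n ≤ (h + 1) * n`, whence `d < h + 1`. The step count then makes the walk end at
-- level 0. Nonnegativity, unlike positivity, also holds at the endpoint.
nonneg⇒Walk : ∀ d n h v s → h + countUp s ≡ d * countDown s →
  (∀ j → j ≤ length s → + 0 ℤ.≤ ht n (h , v) ℤ.+ height (suc d) n s j) → ∃[ A ] Walk d h s A 0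
nonneg⇒Walk d n h v [] e nonneg with trans (sym (+-identityʳ h)) (trans e (*-zeroʳ d))
... | refl = [] , done
nonneg⇒Walk d n h v (up ∷ s) e nonneg
  with nonneg⇒Walk d n (suc h) v s (trans (sym (+-suc h _)) e)
         (λ j j≤ → subst (+ 0 ℤ.≤_) (height-up d n h v s j) (nonneg (suc j) (s≤s j≤)))
... | _ , w = _ , rise w
nonneg⇒Walk d n h v (down ∷ s) e nonneg with m≤n⇒∃[o]m+o≡n d≤h
  where
  after : + 0 ℤ.≤ suc h * n ⊖ (suc v + d * n)
  after = subst (+ 0 ℤ.≤_)
    (begin
      ht n (h , v) ℤ.+ height (suc d) n (down ∷ s) 1   ≡⟨ height-∷ (suc d) n down s 0 (ht n (h , v)) ⟩
      ht n (h , v) ℤ.+ - (+ (d * n + 1)) ℤ.+ + 0       ≡⟨ ℤₚ.+-identityʳ _ ⟩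
      ht n (h , v) ℤ.+ - (+ (d * n + 1))               ≡⟨ cong (λ x → ht n (h , v) ℤ.+ - (+ x)) (+-comm (d * n) 1) ⟩
      ht n (h , v) ℤ.+ ℤ.-[1+ d * n ]                  ≡⟨ ℤₚ.distribˡ-⊖-+-neg (d * n) (suc h * n) v ⟩
      suc h * n ⊖ (suc v + d * n)                      ∎)
    (nonneg 1 (s≤s z≤n))
    where open ≡-Reasoning
  d≤h : d ≤ h
  d≤h = s≤s⁻¹ (*-cancelʳ-< n d (suc h) (<-≤-trans (s≤s (m≤n+m (d * n) v)) (⊖-≥0⇒≤ _ _ after)))
... | h′ , refl
  with nonneg⇒Walk d n h′ (suc v) s
         (+-cancelˡ-≡ d _ _ (trans (sym (+-assoc d h′ _)) (trans e (*-suc d _))))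
         (λ j j≤ → subst (+ 0 ℤ.≤_) (height-down d n h′ v s j) (nonneg (suc j) (s≤s j≤)))
... | _ , w = _ , fall w

-- For the induction on the remaining steps, `f` stays the height function of the whole path and `g`
-- sends a position among these steps to its index. Since `g` is arbitrary, `suc (g j)` need not be
-- `g (suc j)`, hence the separate last hypothesis. An up step is an ascent because steps remain and
-- so `n` is positive; a down step never is.
ascents-points : ∀ (f : ℕ → ℤ) (g : ℕ → ℕ) (w : Walk d h s A 0) → v + countDown s ≡ n →
  (∀ j → f (g j) ≡ ht n (h , v) ℤ.+ height (suc d) n s j) →
  (∀ j → f (suc (g j)) ≡ ht n (h , v) ℤ.+ height (suc d) n s (suc j)) →
  map f (filter (λ i → f i ℤ.<? f (suc i)) (applyUpTo g (length s))) ≡ map (ht n) (points w v)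
ascents-points f g done e p q = refl
ascents-points {d} {v = v} {n} f g w@(rise {h = h} {s} u) e p q =
  trans (cong (map f) (filter-accept (λ i → f i ℤ.<? f (suc i)) ascent))
        (cong₂ _∷_ here (ascents-points f (g ∘ suc) u e (λ j → trans (p (suc j)) (height-up d n h v s j))
                                                       (λ j → trans (q (suc j)) (height-up d n h v s (suc j)))))
  where
  here : f (g 0) ≡ ht n (h , v)
  here = trans (p 0) (ℤₚ.+-identityʳ _)
  next : f (suc (g 0)) ≡ ht n (suc h , v)
  next = trans (q 0) (trans (height-up d n h v s 0) (ℤₚ.+-identityʳ _))
  ascent : f (g 0) ℤ.< f (suc (g 0))
  ascent = subst₂ ℤ._<_ (sym here) (sym next)
    (ℤₚ.⊖-monoˡ-< v (m<n+m (suc h * n) (m<n⇒0<n (countDown-pos⇒< e (countDown>0 w)))))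
ascents-points {d} {v = v} {n} f g (fall {h = h} {s} u) e p q =
  trans (cong (map f) (filter-reject (λ i → f i ℤ.<? f (suc i)) descent))
        (ascents-points f (g ∘ suc) u (trans (sym (+-suc v _)) e)
          (λ j → trans (p (suc j)) (height-down d n h v s j))
          (λ j → trans (q (suc j)) (height-down d n h v s (suc j))))
  where
  here : f (g 0) ≡ ht n (d + h , v)
  here = trans (p 0) (ℤₚ.+-identityʳ _)
  next : f (suc (g 0)) ≡ ht n (h , suc v)
  next = trans (q 0) (trans (height-down d n h v s 0) (ℤₚ.+-identityʳ _))
  descent : ¬ f (g 0) ℤ.< f (suc (g 0))
  descent lt = ℤₚ.<-asym (subst₂ ℤ._<_ here next lt)
    (⊖-< (suc h * n) (suc v) (suc (d + h) * n) v
      (+-mono-≤-< (*-monoˡ-≤ n (s≤s (m≤n+m h d))) ≤-refl))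

height-first-up : ∀ d n s j → height (suc d) n (up ∷ s) (suc j) ≡ ht n (0 , 0) ℤ.+ height (suc d) n s j
height-first-up d n s j = cong (λ x → + x ℤ.+ height (suc d) n s j) (sym (+-identityʳ n))

ascentIndices-heights : (w : Walk d 0 s A 0) → countDown s ≡ n → length s ≡ suc d * n →
  map (height (suc d) n (up ∷ s)) (ascentIndices (suc d) n (up ∷ s)) ≡ map (ht n) (points w 0)
ascentIndices-heights {d} {s} {n = n} w e len rewrite sym len | map-upTo suc (length s) =
  -- The candidate indices start at 1, after the initial up step, hence the index map `suc`.
  ascents-points (height (suc d) n (up ∷ s)) suc w e
    (height-first-up d n s) (height-first-up d n s ∘ suc)

Walk⇒IsCSPath : Walk d 0 s A 0 → IsCSPath (suc d) (countDown s) (up ∷ s)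
Walk⇒IsCSPath {d} {s} w = record
  { ups      = trans (+-comm 1 _) (cong (_+ 1) ups≡)
  ; downs    = refl
  ; len      = trans (+-comm 1 _) (cong (_+ 1) len≡)
  ; ends     = begin
      height (suc d) N (up ∷ s) (suc d * N + 1)      ≡⟨ cong (height (suc d) N (up ∷ s)) (+-comm (suc d * N) 1) ⟩
      height (suc d) N (up ∷ s) (suc (suc d * N))    ≡⟨ cong (λ x → height (suc d) N (up ∷ s) (suc x)) len≡ ⟨
      height (suc d) N (up ∷ s) (suc (length s))     ≡⟨ height-first-up d N s (length s) ⟩
      ht N (0 , 0) ℤ.+ height (suc d) N s (length s) ≡⟨ height-end w 0 ⟩
      (N + 0) ⊖ N                                    ≡⟨ cong (_⊖ N) (+-identityʳ N) ⟩
      N ⊖ N                                          ≡⟨ ℤₚ.n⊖n≡0 N ⟩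
      + 0                                            ∎
  ; positive = λ { (suc j) _ j< → subst (+ 0 ℤ.<_) (sym (height-first-up d N s j))
      (height-positive {v = 0} w refl j (subst (j <_) (sym len≡) j<)) }
  }
  where
  open ≡-Reasoning
  N = countDown s
  ups≡ : countUp s ≡ d * N
  ups≡ = trans (Walk-count w) (+-identityʳ _)
  len≡ : length s ≡ suc d * N
  len≡ = trans (length-steps s) (trans (cong (_+ N) ups≡) (+-comm (d * N) N))

IsCSPath⇒Walk : IsCSPath (suc d) n s → ∃₂ λ s′ A → s ≡ up ∷ s′ × Walk d 0 s′ A 0 × countDown s′ ≡ n × length s′ ≡ suc d * n
IsCSPath⇒Walk {d} {n} {[]} P = contradiction (trans (IsCSPath.len P) (+-comm _ 1)) λ ()
-- A counted down step makes `n` positive, so index 1 is in the range of `positive`, yet the vertex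
-- there has a negative y-coordinate.
IsCSPath⇒Walk {d} {s = down ∷ s} P with IsCSPath.downs P
... | refl with IsCSPath.positive P 1 ≤-refl (s≤s z≤n)
...   | p rewrite +-comm (d * suc (countDown s)) 1 with () ← p
IsCSPath⇒Walk {d} {n} {up ∷ s} P with nonneg⇒Walk d n 0 0 s ups nonneg
  where
  open IsCSPath P renaming (ups to ups₀; len to len₀)
  ups : countUp s ≡ d * countDown s
  ups = suc-injective (trans ups₀ (trans (+-comm _ 1) (cong (λ x → suc (d * x)) (sym downs))))
  nonneg : ∀ j → j ≤ length s → + 0 ℤ.≤ ht n (0 , 0) ℤ.+ height (suc d) n s j
  nonneg j j≤ rewrite sym (height-first-up d n s j) with m≤n⇒m<n∨m≡n j≤
  ... | inj₁ j< = ℤₚ.<⇒≤ (positive (suc j) (s≤s z≤n) (subst (suc j ≤_) (suc-injective (trans len₀ (+-comm _ 1))) j<))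
  ... | inj₂ refl = ℤₚ.≤-reflexive (sym (trans (cong (height (suc d) n (up ∷ s)) len₀) ends))
... | A , w = s , A , refl , w , IsCSPath.downs P , suc-injective (trans (IsCSPath.len P) (+-comm _ 1))

-- Permutations coded by levels

AllPairs-tabulate⁻ : {R : X → X → Set} (f : Fin m → X) → AllPairs R (tabulate f) →
  ∀ {a b} → a Fin.< b → R (f a) (f b)
AllPairs-tabulate⁻ f (r ∷ rs) {Fin.zero}  {Fin.suc b} _   = Allₚ.tabulate⁻ r b
AllPairs-tabulate⁻ f (r ∷ rs) {Fin.suc a} {Fin.suc b} a<b = AllPairs-tabulate⁻ (f ∘ Fin.suc) rs (s≤s⁻¹ a<b)

as-tabulate : (xs : List X) → length xs ≡ m → ∃[ f ] xs ≡ tabulate {n = m} f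
as-tabulate xs refl = lookup xs , sym (tabulate-lookup xs)

map-nth : (f : ℕ → X) (xs : List ℕ) (g : Fin m → X) → map f xs ≡ tabulate g →
  ∀ a → f (nth xs (toℕ a)) ≡ g a
map-nth f (x ∷ xs) g e Fin.zero    = ∷-injectiveˡ e
map-nth f (x ∷ xs) g e (Fin.suc a) = map-nth f xs (g ∘ Fin.suc) (∷-injectiveʳ e) a

tabulate-injective : {f g : Fin m → X} → tabulate f ≡ tabulate g → ∀ a → f a ≡ g a
tabulate-injective e Fin.zero    = ∷-injectiveˡ e
tabulate-injective e (Fin.suc a) = tabulate-injective (∷-injectiveʳ e) a

label : Permutation′ m → Fin m → ℕ
label σ a = suc (toℕ (σ ⟨$⟩ʳ a))

-- The meeting point of the two sides: neither y-coordinates nor trees occur, only a walk from 0 to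
-- 0 and labels that agree with its levels.
LevelCode : ℕ → Permutation′ m → Set
LevelCode {m} d σ = ∃₂ λ s (lev : Fin m → ℕ) → Walk d 0 s (tabulate lev) 0 ×
  (∀ {a b} → a Fin.< b → Agree _<_ (lev a , label σ a) (lev b , label σ b))

ascent-heights : (w : Walk d 0 s A 0) → countDown s ≡ n → length A ≡ m →
  ∃[ p ] points w 0 ≡ tabulate {n = m} p
    × (∀ {a b} → a Fin.< b → Agree ℤ._<_ (proj₁ (p a) , ht n (p a)) (proj₁ (p b) , ht n (p b)))
    × (∀ a → height (suc d) n (up ∷ s) (nth (ascentIndices (suc d) n (up ∷ s)) (toℕ a)) ≡ ht n (p a))
ascent-heights {d} {s} {n = n} w e len with as-tabulate (points w 0)
    (trans (sym (length-map proj₁ (points w 0))) (trans (cong length (points-levels w 0)) len))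
... | p , pts = p , pts
  , AllPairs-tabulate⁻ p (subst (AllPairs _) pts (points-Agree w e))
  , map-nth _ (ascentIndices (suc d) n (up ∷ s)) (ht n ∘ p)
      (trans (ascentIndices-heights w e steps) (trans (cong (map (ht n)) pts) (map-tabulate p (ht n))))
  where
  steps : length s ≡ suc d * n
  steps = trans (length-steps s) (trans (cong₂ _+_ (trans (Walk-count w) (trans (+-identityʳ _) (cong (d *_) e))) e) (+-comm (d * n) n))

-- The heights at the ascents agree with the levels, and the order condition on `σ` lets the labels
-- take their place.
IsShortKCS⇒LevelCode : (σ : Permutation′ m) → IsShortKCS (suc d) n σ → LevelCode d σ
IsShortKCS⇒LevelCode {m} {d} {n} σ (m≡ , _ , P , ord) with IsCSPath⇒Walk P
... | s , A , refl , w , e , _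
  with ascent-heights w e (trans (Walk-length w) (trans (Walk-count w) (trans (+-identityʳ _) (trans (cong (d *_) e) (sym m≡)))))
... | p , pts , agree , heights = s , proj₁ ∘ p
  , subst (λ A → Walk d 0 s A 0) (trans (sym (points-levels w 0)) (trans (cong (map proj₁) pts) (map-tabulate p proj₁))) w
  , λ {a} {b} a<b → Sum.map (λ (l , z) → l , order a b z) (λ (l , z) → l , order b a z) (agree a<b)
  where
  order : ∀ a b → ht n (p a) ℤ.< ht n (p b) → label σ a < label σ b
  order a b lt = s≤s (Equivalence.from (ord a b) (subst₂ ℤ._<_ (sym (heights a)) (sym (heights b)) lt))

-- The order is the number of down steps of the walk. Labels and heights agree with the same levels,
-- so they are ordered alike.
LevelCode⇒IsShortKCS : (σ : Permutation′ m) → LevelCode d σ → ∃[ n ] IsShortKCS (suc d) n σ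
LevelCode⇒IsShortKCS {m} {d} σ (s , lev , w , agree)
  with ascent-heights w refl (length-tabulate lev)
... | p , pts , agreeʰ , heights = countDown s
  , trans (sym (length-tabulate lev)) (trans (Walk-length w) (trans (Walk-count w) (+-identityʳ _)))
  , up ∷ s , Walk⇒IsCSPath w
  , λ a b → mk⇔
      (λ lt → subst₂ ℤ._<_ (sym (heights a)) (sym (heights b)) (Equivalence.to (order a b) (s≤s lt)))
      (λ lt → s≤s⁻¹ (Equivalence.from (order a b) (subst₂ ℤ._<_ (heights a) (heights b) lt)))
  where
  levels : ∀ a → proj₁ (p a) ≡ lev a
  levels a = tabulate-injective (trans (sym (map-tabulate p proj₁)) (trans (cong (map proj₁) (sym pts)) (points-levels w 0))) a
  order : ∀ a b → label σ a < label σ b ⇔ ht (countDown s) (p a) ℤ.< ht (countDown s) (p b)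
  order = Agree-tabulate-⇔ _<_ ℤ._<_ <-asym ℤₚ.<-asym agree
    (λ {a} {b} a<b → subst₂ (λ i j → Agree ℤ._<_ (i , ht _ (p a)) (j , ht _ (p b))) (levels a) (levels b) (agreeʰ a<b))

-- Foata–Strehl trees

-- A relational form without fuel: induction on it supplies the factorization of the word at its
-- minimum together with strict minimality.
data IsFS : List ℕ → Tree → Set where
  leaf : IsFS [] leaf
  node : ∀ {xs ys μ l r} → All (μ <_) xs → All (μ <_) ys → IsFS xs l → IsFS ys r →
         IsFS (xs ++ μ ∷ ys) (node l μ r)

foldr-⊓-≤ : ∀ x xs → All (foldr _⊓_ x xs ≤_) (x ∷ xs)
foldr-⊓-≤ x []       = ≤-refl ∷ []
foldr-⊓-≤ x (y ∷ ys) with foldr-⊓-≤ x ys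
... | p ∷ ps = ≤-trans (m⊓n≤n y _) p ∷ m⊓n≤m y _ ∷ All.map (≤-trans (m⊓n≤n y _)) ps

foldr-⊓-∈ : ∀ x xs → foldr _⊓_ x xs ∈ x ∷ xs
foldr-⊓-∈ x xs with foldr-selective ⊓-sel x xs
... | inj₁ e = Any.here e
... | inj₂ p = Any.there p

AllPairs-++⁻ : {R : X → X → Set} (xs : List X) {y : X} {ys : List X} → AllPairs R (xs ++ y ∷ ys) →
  AllPairs R xs × AllPairs R ys × All (λ x → R x y) xs × All (R y) ys
AllPairs-++⁻ []       (r ∷ rs) = [] , rs , [] , r
AllPairs-++⁻ (x ∷ xs) (r ∷ rs) with AllPairs-++⁻ xs rs | Allₚ.++⁻ xs r
... | ps , qs , before , after | rx , ry ∷ _ = rx ∷ ps , qs , ry ∷ before , after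

takeWhile-≢ : ∀ {μ} xs {ys} → All (_≢ μ) xs → takeWhile (λ y → ¬? (y ≟ μ)) (xs ++ μ ∷ ys) ≡ xs
takeWhile-≢ {μ} [] [] rewrite dec-true (μ ≟ μ) refl = refl
takeWhile-≢ {μ} (x ∷ xs) (x≢μ ∷ p) rewrite dec-false (x ≟ μ) x≢μ = cong (x ∷_) (takeWhile-≢ xs p)

dropWhile-≢ : ∀ {μ} xs {ys} → All (_≢ μ) xs → dropWhile (λ y → ¬? (y ≟ μ)) (xs ++ μ ∷ ys) ≡ μ ∷ ys
dropWhile-≢ {μ} [] [] rewrite dec-true (μ ≟ μ) refl = refl
dropWhile-≢ {μ} (x ∷ xs) (x≢μ ∷ p) rewrite dec-false (x ≟ μ) x≢μ = dropWhile-≢ xs p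

FS′-split : ∀ f {x xs} ys {zs} → let μ = foldr _⊓_ x xs in x ∷ xs ≡ ys ++ μ ∷ zs → All (_≢ μ) ys →
  FS′ (suc f) (x ∷ xs) ≡ node (FS′ f ys) μ (FS′ f zs)
FS′-split f {x} {xs} ys {zs} e ys≢ = cong₂ (λ us vs → node (FS′ f us) μ (FS′ f vs))
  (trans (cong (takeWhile ≢μ?) e) (takeWhile-≢ ys ys≢))
  (trans (cong (drop 1 ∘ dropWhile ≢μ?) e) (cong (drop 1) (dropWhile-≢ ys ys≢)))
  where
  μ = foldr _⊓_ x xs
  ≢μ? = λ (y : ℕ) → ¬? (y ≟ μ)

FS′-isFS : ∀ f w → Unique w → length w ≤ f → IsFS w (FS′ f w)
FS′-isFS zero    []       u len = leaf
FS′-isFS (suc f) []       u len = leaf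
FS′-isFS (suc f) (x ∷ xs) u len with ∈-∃++ (foldr-⊓-∈ x xs)
... | ys , zs , e with AllPairs-++⁻ ys (subst Unique e u) | Allₚ.++⁻ ys (subst (All _) e (foldr-⊓-≤ x xs))
... | uys , uzs , ys≢ , zs≢ | ≤ys , _ ∷ ≤zs =
  subst₂ IsFS (sym e) (sym (FS′-split f ys e ys≢)) (node
    -- Distinctness of the letters turns the weak minimality of the fold into strict minimality.
    (All.zipWith (λ (μ≤y , y≢μ) → ≤∧≢⇒< μ≤y (y≢μ ∘ sym)) (≤ys , ys≢))
    (All.zipWith (λ (μ≤z , μ≢z) → ≤∧≢⇒< μ≤z μ≢z) (≤zs , zs≢))
    (FS′-isFS f ys uys (m+n≤o⇒m≤o (length ys) lengths))
    (FS′-isFS f zs uzs (m+n≤o⇒n≤o (length ys) lengths)))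
  where
  lengths : length ys + length zs ≤ f
  lengths = s≤s⁻¹ (subst (_≤ suc f)
    (trans (cong length e) (trans (length-++ ys) (+-suc (length ys) (length zs)))) len)

FS-isFS : ∀ w → Unique w → IsFS w (FS w)
FS-isFS w u = FS′-isFS (length w) w u ≤-refl

-- Inorder reading of levels and labels

-- The offset `h` is the level given to the root, so that a right subtree is the same problem at
-- `suc h`.
inorder : ℕ → Tree → List (ℕ × ℕ)
inorder h leaf         = []
inorder h (node l x r) = inorder h l ++ (h , x) ∷ inorder (suc h) r

inorder-word : ∀ {w} h → IsFS w T → map proj₂ (inorder h T) ≡ w
inorder-word h leaf = refl
inorder-word h (node {μ = μ} {l = l} {r} _ _ fsˡ fsʳ) = trans (map-++ proj₂ (inorder h l) _)
  (cong₂ (λ xs ys → xs ++ μ ∷ ys) (inorder-word h fsˡ) (inorder-word (suc h) fsʳ))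

inorder-levels : ∀ h l x r →
  map proj₁ (inorder h (node l x r)) ≡ map proj₁ (inorder h l) ++ h ∷ map proj₁ (inorder (suc h) r)
inorder-levels h l x r = map-++ proj₁ (inorder h l) _

Coherent : List (ℕ × ℕ) → Set
Coherent = AllPairs (Agree _<_)

map-++-∷⁻ : (f : X → Y) (ps : List X) (xs : List Y) {y : Y} {ys : List Y} → map f ps ≡ xs ++ y ∷ ys →
  ∃[ ps₁ ] ∃[ p ] ∃[ ps₂ ] ps ≡ ps₁ ++ p ∷ ps₂ × map f ps₁ ≡ xs × f p ≡ y × map f ps₂ ≡ ys
map-++-∷⁻ f (p ∷ ps) [] e = [] , p , ps , refl , refl , ∷-injectiveˡ e , ∷-injectiveʳ e
map-++-∷⁻ f (p ∷ ps) (x ∷ xs) e with map-++-∷⁻ f ps xs (∷-injectiveʳ e)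
... | ps₁ , q , ps₂ , refl , e₁ , eq , e₂ = p ∷ ps₁ , q , ps₂ , refl , cong₂ _∷_ (∷-injectiveˡ e) e₁ , eq , e₂

-- The last minimum level is also the minimum label, so the level sequence is
-- cut at the same place as the word.
Walk⇒inorder : ∀ {w} → IsFS w T → (ps : List (ℕ × ℕ)) → map proj₂ ps ≡ w → Coherent ps →
  Walk d h s (map proj₁ ps) c → All (λ p → h ≤ proj₁ p) ps → inorder h T ≡ ps
Walk⇒inorder leaf [] e coh w above = refl
Walk⇒inorder {d = d} {h = h} {c = c} (node {xs} {ys} {μ} {l} {r} μ<xs μ<ys fsˡ fsʳ) ps e coh w above
  with map-++-∷⁻ proj₂ ps xs e
... | ps₁ , (a , .μ) , ps₂ , refl , refl , refl , refl
  with AllPairs-++⁻ ps₁ coh | Allₚ.++⁻ ps₁ above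
... | coh₁ , coh₂ , before , after | above₁ , h≤a ∷ above₂
  with ≤-antisym h≤a (a≤h ps₁ (Allₚ.map⁻ μ<xs) before w)
  where
  -- The first recorded level is at most `h`. If it belongs to an entry before the minimum, that
  -- entry has a label above `μ`, so `Agree` puts `a` at or below its level.
  a≤h : ∀ ps₁ → All (λ p → μ < proj₂ p) ps₁ → All (λ p → Agree _<_ p (a , μ)) ps₁ →
        Walk d h s (map proj₁ (ps₁ ++ (a , μ) ∷ ps₂)) c → a ≤ h
  a≤h []      _       _                     w = Walk-head≤ w
  a≤h (_ ∷ _) (μ<x ∷ _) (inj₁ (_ , x<μ) ∷ _) w = contradiction x<μ (<-asym μ<x)
  a≤h (_ ∷ _) _       (inj₂ (a≤b , _) ∷ _)  w = ≤-trans a≤b (Walk-head≤ w)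
... | refl with Walk-split (map proj₁ ps₁) (subst (λ A → Walk d h _ A c) (map-++ proj₁ ps₁ _) w)
... | (_ , w₁) , (_ , w₂) = cong₂ (λ xs ys → xs ++ (h , μ) ∷ ys)
  (Walk⇒inorder fsˡ ps₁ refl coh₁ w₁ above₁)
  (Walk⇒inorder fsʳ ps₂ refl coh₂ w₂ (All.zipWith higher (Allₚ.map⁻ μ<ys , after)))
  where
  -- Labels after the minimum exceed it, so `Agree` can hold only through a strictly higher level;
  -- the right subtree thus starts at `suc h`.
  higher : ∀ {p} → μ < proj₂ p × Agree _<_ (h , μ) p → h < proj₁ p
  higher (_   , inj₁ (h<b , _)) = h<b
  higher (μ<y , inj₂ (_ , y<μ)) = contradiction y<μ (<-asym μ<y)

-- Levelwise numbering as coherence of the inorder reading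

labelAt-inorder : ∀ h T p {x} → labelAt T p ≡ just x → (h + level p , x) ∈ inorder h T
labelAt-inorder h (node l x r) []      refl rewrite +-identityʳ h = ∈-++⁺ʳ (inorder h l) (Any.here refl)
labelAt-inorder h (node l x r) (L ∷ p) e = ∈-++⁺ˡ (labelAt-inorder h l p e)
labelAt-inorder h (node l x r) (R ∷ p) e rewrite +-suc h (level p) =
  ∈-++⁺ʳ (inorder h l) (Any.there (labelAt-inorder (suc h) r p e))

inorder-labelAt : ∀ h T → All (λ (a , x) → ∃[ p ] labelAt T p ≡ just x × a ≡ h + level p) (inorder h T)
inorder-labelAt h leaf = []
inorder-labelAt h (node l x r) = Allₚ.++⁺
  (All.map (λ (p , e , q) → L ∷ p , e , q) (inorder-labelAt h l))
  (([] , refl , sym (+-identityʳ h))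
   ∷ All.map (λ (p , e , q) → R ∷ p , e , trans q (sym (+-suc h (level p)))) (inorder-labelAt (suc h) r))

module _ {l r : Tree} {x : ℕ} where

  LevelwiseNumbered-left : LevelwiseNumbered (node l x r) → LevelwiseNumbered l
  LevelwiseNumbered-left N = record
    { cond1 = λ p q → cond1 (L ∷ p) (L ∷ q)
    ; cond2 = λ { p q i j ei ej (t , refl) → cond2 (L ∷ p) (L ∷ q) i j ei ej (t , refl) }
    ; cond3 = λ { p q s i j k ei ej ek lv ki kj (t , refl) (u , refl) →
        cond3 (L ∷ p) (L ∷ q) (L ∷ s) i j k ei ej ek lv ki kj (t , refl) (u , refl) }
    }
    where open LevelwiseNumbered N

  LevelwiseNumbered-right : LevelwiseNumbered (node l x r) → LevelwiseNumbered r
  LevelwiseNumbered-right N = record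
    { cond1 = λ p q i j ei ej lt → cond1 (R ∷ p) (R ∷ q) i j ei ej (s≤s lt)
    ; cond2 = λ { p q i j ei ej (t , refl) → cond2 (R ∷ p) (R ∷ q) i j ei ej (t , refl) }
    ; cond3 = λ { p q s i j k ei ej ek lv ki kj (t , refl) (u , refl) →
        cond3 (R ∷ p) (R ∷ q) (R ∷ s) i j k ei ej ek (cong suc lv) ki kj (t , refl) (u , refl) }
    }
    where open LevelwiseNumbered N

-- Pairs meeting at the root are of three kinds: root and right subtree use `cond1`, left subtree
-- and root use `cond2`, and left against right uses `cond1` when the levels differ and `cond3` at
-- the root when they are equal.
LevelwiseNumbered⇒Coherent : ∀ h T → LevelwiseNumbered T → Coherent (inorder h T)
LevelwiseNumbered⇒Coherent h leaf         N = []
LevelwiseNumbered⇒Coherent h (node l x r) N = AllPairsₚ.++⁺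
  (LevelwiseNumbered⇒Coherent h l (LevelwiseNumbered-left N))
  (All.map root-right (inorder-labelAt (suc h) r)
   ∷ LevelwiseNumbered⇒Coherent (suc h) r (LevelwiseNumbered-right N))
  (All.map (λ ∈l → left-root ∈l ∷ All.map (left-right ∈l) (inorder-labelAt (suc h) r)) (inorder-labelAt h l))
  where
  open LevelwiseNumbered N
  Located : ℕ → Tree → ℕ × ℕ → Set
  Located h T (a , i) = ∃[ p ] labelAt T p ≡ just i × a ≡ h + level p
  root-right : ∀ {q} → Located (suc h) r q → Agree _<_ (h , x) q
  root-right (p , e , refl) = inj₁ (s≤s (m≤m+n h (level p)) , cond1 [] (R ∷ p) x _ refl e z<s)
  left-root : ∀ {q} → Located h l q → Agree _<_ q (h , x)
  left-root (p , e , refl) = inj₂ (m≤m+n h (level p) , cond2 [] (L ∷ p) x _ refl e (p , refl))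
  left-right : ∀ {q q′} → Located h l q → Located (suc h) r q′ → Agree _<_ q q′
  left-right (p , e , refl) (p′ , e′ , refl) rewrite sym (+-suc h (level p′)) with <-cmp (level p) (suc (level p′))
  ... | tri< lt _ _ = inj₁ (+-monoʳ-< h lt , cond1 (L ∷ p) (R ∷ p′) _ _ e e′ lt)
  ... | tri> _ _ gt = inj₂ (+-monoʳ-≤ h (<⇒≤ gt) , cond1 (R ∷ p′) (L ∷ p) _ _ e′ e gt)
  ... | tri≈ _ eq _ = inj₂ (+-monoʳ-≤ h (≤-reflexive (sym eq)) ,
    cond3 (R ∷ p′) (L ∷ p) [] _ _ x e′ e refl (sym eq)
      (cond1 [] (R ∷ p′) _ _ refl e′ z<s) (cond2 [] (L ∷ p) _ _ refl e (p , refl))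
      (p′ , refl) (p , refl))

-- In each case the levels of the two vertices exclude one branch of `Agree`, and the other branch
-- is the required inequality of labels.
Coherent⇒LevelwiseNumbered : ∀ h T → Coherent (inorder h T) → LevelwiseNumbered T
Coherent⇒LevelwiseNumbered h leaf coh = record
  { cond1 = λ _ _ _ _ () ; cond2 = λ _ _ _ _ () ; cond3 = λ _ _ _ _ _ _ () }
Coherent⇒LevelwiseNumbered h (node l x r) coh = record { cond1 = cond1 ; cond2 = cond2 ; cond3 = cond3 }
  where
  parts = AllPairs-++⁻ (inorder h l) coh
  module Nˡ = LevelwiseNumbered (Coherent⇒LevelwiseNumbered h l (proj₁ parts))
  module Nʳ = LevelwiseNumbered (Coherent⇒LevelwiseNumbered (suc h) r (proj₁ (proj₂ parts)))

  root<left : ∀ p {i} → labelAt l p ≡ just i → x < i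
  root<left p e with All.lookup (proj₁ (proj₂ (proj₂ parts))) (labelAt-inorder h l p e)
  ... | inj₁ (lt , _) = contradiction lt (≤⇒≯ (m≤m+n h (level p)))
  ... | inj₂ (_ , x<) = x<

  root<right : ∀ p {i} → labelAt r p ≡ just i → x < i
  root<right p e with All.lookup (proj₂ (proj₂ (proj₂ parts))) (labelAt-inorder (suc h) r p e)
  ... | inj₁ (_ , x<) = x<
  ... | inj₂ (le , _) = contradiction (s≤s (m≤m+n h (level p))) (≤⇒≯ le)

  left-right : ∀ p q {i j} → labelAt l p ≡ just i → labelAt r q ≡ just j →
    Agree _<_ (h + level p , i) (h + suc (level q) , j)
  left-right p q ei ej rewrite +-suc h (level q) =
    All.lookup (All.lookup (cross (inorder h l) coh) (labelAt-inorder h l p ei)) (labelAt-inorder (suc h) r q ej)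
    where
    cross : ∀ xs {y ys} → Coherent (xs ++ y ∷ ys) → All (λ p → All (Agree _<_ p) ys) xs
    cross []       _        = []
    cross (x ∷ xs) (r ∷ rs) = All.tail (Allₚ.++⁻ʳ xs r) ∷ cross xs rs

  left<right : ∀ p q {i j} → labelAt l p ≡ just i → labelAt r q ≡ just j → level p < suc (level q) → i < j
  left<right p q ei ej lt with left-right p q ei ej
  ... | inj₁ (_ , i<j) = i<j
  ... | inj₂ (le , _)  = contradiction (+-cancelˡ-≤ h _ _ le) (<⇒≱ lt)

  right<left : ∀ p q {i j} → labelAt l p ≡ just i → labelAt r q ≡ just j → suc (level q) ≤ level p → j < i
  right<left p q ei ej le with left-right p q ei ej
  ... | inj₁ (lt , _)  = contradiction (+-cancelˡ-< h _ _ lt) (≤⇒≯ le)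
  ... | inj₂ (_ , j<i) = j<i

  cond1 : ∀ p q i j → labelAt (node l x r) p ≡ just i → labelAt (node l x r) q ≡ just j → level p < level q → i < j
  cond1 []      (L ∷ q) _ _ refl ej lt = root<left q ej
  cond1 []      (R ∷ q) _ _ refl ej lt = root<right q ej
  cond1 (L ∷ p) (L ∷ q) i j ei ej lt = Nˡ.cond1 p q i j ei ej lt
  cond1 (L ∷ p) (R ∷ q) i j ei ej lt = left<right p q ei ej lt
  cond1 (R ∷ p) (L ∷ q) i j ei ej lt = right<left q p ej ei (<⇒≤ lt)
  cond1 (R ∷ p) (R ∷ q) i j ei ej lt = Nʳ.cond1 p q i j ei ej (s≤s⁻¹ lt)

  cond2 : ∀ p q i j → labelAt (node l x r) p ≡ just i → labelAt (node l x r) q ≡ just j →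
    ∃[ t ] q ≡ p ++ L ∷ t → i < j
  cond2 []      _ _ _ refl ej (t , refl) = root<left t ej
  cond2 (L ∷ p) _ i j ei   ej (t , refl) = Nˡ.cond2 p _ i j ei ej (t , refl)
  cond2 (R ∷ p) _ i j ei   ej (t , refl) = Nʳ.cond2 p _ i j ei ej (t , refl)

  cond3 : ∀ p q s i j k → labelAt (node l x r) p ≡ just i → labelAt (node l x r) q ≡ just j →
    labelAt (node l x r) s ≡ just k → level p ≡ level q → k < i → k < j →
    ∃[ t ] p ≡ s ++ R ∷ t → ∃[ t ] q ≡ s ++ L ∷ t → i < j
  cond3 _ _ []      i j k ei ej ek lv ki kj (t , refl) (u , refl) = right<left u t ej ei (≤-reflexive lv)
  cond3 _ _ (L ∷ s) i j k ei ej ek lv ki kj (t , refl) (u , refl) =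
    Nˡ.cond3 _ _ s i j k ei ej ek lv ki kj (t , refl) (u , refl)
  cond3 _ _ (R ∷ s) i j k ei ej ek lv ki kj (t , refl) (u , refl) =
    Nʳ.cond3 _ _ s i j k ei ej ek (suc-injective lv) ki kj (t , refl) (u , refl)

-- Right paths and down steps

-- The right path through the root is left out, because for a right subtree it is only the tail of a
-- maximal path. An absent left child contributes the harmless `d ∣ 0`.
LeftSpines∣ : ℕ → Tree → Set
LeftSpines∣ d leaf         = ⊤
LeftSpines∣ d (node l _ r) = d ∣ rightSpine l × LeftSpines∣ d l × LeftSpines∣ d r

LeftSpines∣⁺ : ∀ T → (∀ q x → labelAt T (q ++ L ∷ []) ≡ just x → d ∣ rightSpine (subtreeAt T (q ++ L ∷ []))) →
  LeftSpines∣ d T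
LeftSpines∣⁺ leaf D = tt
LeftSpines∣⁺ {d} (node l _ r) D = spine l (D []) , LeftSpines∣⁺ l (D ∘ (L ∷_)) , LeftSpines∣⁺ r (D ∘ (R ∷_))
  where
  spine : ∀ l → (∀ x → labelAt l [] ≡ just x → d ∣ rightSpine l) → d ∣ rightSpine l
  spine leaf         _ = d ∣0
  spine (node _ x _) D = D x refl

LeftSpines∣⁻ : ∀ T → LeftSpines∣ d T →
  ∀ q x → labelAt T (q ++ L ∷ []) ≡ just x → d ∣ rightSpine (subtreeAt T (q ++ L ∷ []))
LeftSpines∣⁻ (node l _ r) (D , _ , _)   []      x e = D
LeftSpines∣⁻ (node l _ r) (_ , Dˡ , Dʳ) (L ∷ q) x e = LeftSpines∣⁻ l Dˡ q x e
LeftSpines∣⁻ (node l _ r) (_ , Dˡ , Dʳ) (R ∷ q) x e = LeftSpines∣⁻ r Dʳ q x e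

RightPathsDivisible⇔ : ∀ T → RightPathsDivisible d T ⇔ (d ∣ rightSpine T × LeftSpines∣ d T)
RightPathsDivisible⇔ {d} T = mk⇔
  (λ D → root T (D [] (inj₁ refl)) , LeftSpines∣⁺ T (λ q x e → D _ (inj₂ (q , refl)) (x , e)))
  (λ { (D , Ds) _ (inj₁ refl) _ → D
     ; (D , Ds) _ (inj₂ (q , refl)) (x , e) → LeftSpines∣⁻ T Ds q x e })
  where
  root : ∀ T → (∃[ x ] labelAt T [] ≡ just x → d ∣ rightSpine T) → d ∣ rightSpine T
  root leaf         _ = d ∣0
  root (node _ x _) D = D (x , refl)

-- The left subtree is read first and must lead back to `h`, where the root's up step starts; its
-- spine raises the level by `q * d`, undone by `q` down steps. After the last up step the level is
-- `h + rightSpine T`, and `t` down steps lead to `c`.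
spines⇒Walk : ∀ T {h} t → h + rightSpine T ≡ t * d + c → LeftSpines∣ d T →
  ∃[ s ] Walk d h s (map proj₁ (inorder h T)) c
spines⇒Walk {d} {c} leaf {h} t e _ =
  replicate t down , subst (λ h → Walk d h (replicate t down) [] c) (trans (sym e) (+-identityʳ h)) (Walk-descend d t c)
spines⇒Walk {d} {c} (node l x r) {h} t e (divides q l≡ , Dˡ , Dʳ)
  with spines⇒Walk l {h} q (trans (cong (λ i → h + i) l≡) (+-comm h (q * d))) Dˡ
     | spines⇒Walk r {suc h} t (trans (sym (+-suc h _)) e) Dʳ
... | _ , wˡ | _ , wʳ =
  _ , subst (λ A → Walk d h _ A c) (sym (inorder-levels h l x r)) (Walk-++ wˡ (rise wʳ))

-- Cutting at the root's up step leaves for the left subtree a walk from `h` back to `h`, whose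
-- spine is therefore a multiple of `d`. The witness `t` counts the down steps after the last up
-- step.
Walk⇒spines : ∀ T {h} → Walk d h s (map proj₁ (inorder h T)) c →
  (∃[ t ] h + rightSpine T ≡ t * d + c) × LeftSpines∣ d T
Walk⇒spines leaf {h} w with Walk-[] w
... | t , e = (t , trans (+-identityʳ h) e) , tt
Walk⇒spines {d} {c = c} (node l x r) {h} w
  with Walk-split (map proj₁ (inorder h l)) (subst (λ A → Walk d h _ A c) (inorder-levels h l x r) w)
... | (_ , wˡ) , (_ , wʳ) with Walk⇒spines l wˡ | Walk⇒spines r wʳ
... | (q , eˡ) , Dˡ | (t , eʳ) , Dʳ =
  (t , trans (+-suc h _) eʳ) , divides q (+-cancelˡ-≡ h _ _ (trans eˡ (+-comm (q * d) h))) , Dˡ , Dʳ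

-- The equivalences for permutations

word-tabulate : (σ : Permutation′ m) → word σ ≡ tabulate (label σ)
word-tabulate σ = map-tabulate (λ a → a) (label σ)

word-isFS : (σ : Permutation′ m) → IsFS (word σ) (FS (word σ))
word-isFS σ = FS-isFS (word σ) (subst Unique (sym (word-tabulate σ))
  (Uniqueₚ.tabulate⁺ (Injection.injective (↔⇒↣ σ) ∘ Finₚ.toℕ-injective ∘ suc-injective)))

-- Forward, `Walk⇒inorder` identifies the coded levels with the tree levels, and both conditions are
-- read off. Backward, the inorder levels of the tree serve as the code.
LevelCode⇔ : (σ : Permutation′ m) →
  LevelCode d σ ⇔ (LevelwiseNumbered (FS (word σ)) × RightPathsDivisible d (FS (word σ)))
LevelCode⇔ {m} {d} σ = mk⇔ to from
  where
  FSσ = FS (word σ)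
  to : LevelCode d σ → LevelwiseNumbered FSσ × RightPathsDivisible d FSσ
  to (s , lev , w , agree) =
    Coherent⇒LevelwiseNumbered 0 FSσ (subst Coherent (sym inorder≡) coh) ,
    Equivalence.from (RightPathsDivisible⇔ FSσ) (divides q (trans e (+-identityʳ (q * d))) , D)
    where
    ps : List (ℕ × ℕ)
    ps = tabulate (λ a → lev a , label σ a)
    coh : Coherent ps
    coh = AllPairsₚ.tabulate⁺-< agree
    w′ : Walk d 0 s (map proj₁ ps) 0
    w′ = subst (λ A → Walk d 0 s A 0) (sym (map-tabulate _ proj₁)) w
    inorder≡ : inorder 0 FSσ ≡ ps
    inorder≡ = Walk⇒inorder (word-isFS σ) ps (trans (map-tabulate _ proj₂) (sym (word-tabulate σ))) coh w′
      (All.universal (λ _ → z≤n) ps)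
    spines = Walk⇒spines FSσ (subst (λ ps → Walk d 0 s (map proj₁ ps) 0) (sym inorder≡) w′)
    q = proj₁ (proj₁ spines)
    e = proj₂ (proj₁ spines)
    D = proj₂ spines
  from : LevelwiseNumbered FSσ × RightPathsDivisible d FSσ → LevelCode d σ
  from (N , P) with Equivalence.to (RightPathsDivisible⇔ FSσ) P
  ... | divides q e , D with spines⇒Walk FSσ {0} q (trans e (sym (+-identityʳ (q * d)))) D
  ... | s , w with as-tabulate (inorder 0 FSσ)
      (trans (sym (length-map proj₂ (inorder 0 FSσ)))
        (trans (cong length (trans (inorder-word 0 (word-isFS σ)) (word-tabulate σ))) (length-tabulate (label σ))))
  ... | p , p≡ = s , proj₁ ∘ p
    , subst (λ A → Walk d 0 s A 0) (trans (cong (map proj₁) p≡) (map-tabulate p proj₁)) w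
    , λ {a} {b} a<b → subst₂ (λ i j → Agree _<_ (proj₁ (p a) , i) (proj₁ (p b) , j)) (labels a) (labels b)
        (AllPairs-tabulate⁻ p (subst Coherent p≡ (LevelwiseNumbered⇒Coherent 0 FSσ N)) a<b)
    where
    labels : ∀ a → proj₂ (p a) ≡ label σ a
    labels = tabulate-injective (trans (sym (map-tabulate p proj₂)) (trans (cong (map proj₂) (sym p≡))
      (trans (inorder-word 0 (word-isFS σ)) (word-tabulate σ))))

ShortKCS⇔ : ∀ d (σ : Permutation′ m) → (∃[ n ] IsShortKCS (suc d) n σ) ⇔
  (LevelwiseNumbered (FS (word σ)) × RightPathsDivisible d (FS (word σ)))
ShortKCS⇔ d σ = mk⇔
  (λ (n , K) → Equivalence.to (LevelCode⇔ σ) (IsShortKCS⇒LevelCode σ K))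
  (LevelCode⇒IsShortKCS σ ∘ Equivalence.from (LevelCode⇔ σ))

theorem4p13 : (∀ (n : ℕ) (σ : Permutation′ n) →
    IsShortKCS 2 n σ ⇔ LevelwiseNumbered (FS (word σ)))
    ×
    (∀ (k : ℕ) → 2 ≤ k → ∀ (m : ℕ) (σ : Permutation′ m) →
    (∃[ n ] IsShortKCS k n σ) ⇔
    (LevelwiseNumbered (FS (word σ)) × RightPathsDivisible (k ∸ 1) (FS (word σ))))
theorem4p13 = (λ n σ → mk⇔
      (λ K → proj₁ (Equivalence.to (ShortKCS⇔ 1 σ) (n , K)))
      -- For `k = 2` the divisor is 1, so the condition on right paths is automatic.
      (λ N → order≡ σ (Equivalence.from (ShortKCS⇔ 1 σ) (N , λ _ _ _ → 1∣ _))))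
  , λ { (suc d) _ m σ → ShortKCS⇔ d σ }
  where
  -- The length condition for `k = 2` reads `n ≡ 1 * n′`, which fixes the order.
  order≡ : ∀ {n} (σ : Permutation′ n) → ∃[ n′ ] IsShortKCS 2 n′ σ → IsShortKCS 2 n σ
  order≡ σ (n′ , K) = subst (λ i → IsShortKCS 2 i σ) (trans (sym (*-identityˡ n′)) (sym (proj₁ K))) K
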